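{- There exists an absolute constant $C>0$ such that for every $N$ there is a convex set $A\subset\mathbb{R}$ with $|A|\geq N$ and $S(A)\leq C|A|^{3/4}$.
   Context: A convex set is a finite set $A=\{a_1<\cdots<a_n\}\subset\mathbb{R}$ whose consecutive differences $a_{i+1}-a_i$ form a strictly increasing sequence. A set $B$ is Sidon if the only solutions of $a+b=c+d$ with $a,b,c,d\in B$ have $\{a,b\}=\{c,d\}$. $S(A)=\max\{|B|: B\subseteq A,\ B\text{ Sidon}\}$. -}

module Defs where

open import Data.Nat using (ℕ; _≤_; _*_; _^_)
open import Data.Integer using (ℤ; _+_; _-_; _<_)
open import Data.List using (List; []; _∷_; length)
open import Data.List.Relation.Unary.Linked using (Linked)
open import Data.List.Membership.Propositional using (_∈_)
open import Data.List.Relation.Binary.Sublist.Propositional using (_⊆_)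
open import Data.Product using (_×_)
open import Data.Sum using (_⊎_)
open import Relation.Binary.PropositionalEquality using (_≡_)

diffs : List ℤ → List ℤ
diffs (x ∷ y ∷ xs) = (y - x) ∷ diffs (y ∷ xs)
diffs _ = []

-- A finite set A = {a_1 < ... < a_n} represented as its increasing list;
-- convex: strictly increasing with strictly increasing consecutive differences.
Convex : List ℤ → Set
Convex A = Linked _<_ A × Linked _<_ (diffs A)

Sidon : List ℤ → Set
Sidon B = ∀ {a b c d} → a ∈ B → b ∈ B → c ∈ B → d ∈ B →
          a + b ≡ c + d → (a ≡ c × b ≡ d) ⊎ (a ≡ d × b ≡ c)

-- S(A) ≤ C |A|^{3/4}, stated via every Sidon subset B ⊆ A
-- (B a sublist of the strictly increasing list A, hence a subset of
-- size length B), in the equivalent 4th-power form |B|^4 ≤ K |A|^3.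
SidonBound : ℕ → List ℤ → Set
SidonBound K A = ∀ (B : List ℤ) → B ⊆ A → Sidon B → length B ^ 4 ≤ K * length A ^ 3

{-# OPTIONS --safe #-}
-- If A ⊆ X + Y and B ⊆ A is Sidon, then {(x , y) | x + y ∈ B} is a bipartite graph without
-- 4-cycles, so |B|² ≪ p³ when |X| , |Y| ≤ p.  It therefore suffices to find a convex set of size
-- ≫ M² inside a sumset X + Y with |X| , |Y| ≪ M.
--
-- Up to a perturbation take the numbers n² + 2nd = (n + d)² − d².  For fixed n they form a
-- progression in d of step 2n.  Let run n end at d = (n + 1) Qₙ and run n + 1 start at d = n Qₙ:
-- the jump between these two points is exactly 2n + 1, between the steps 2n and 2n + 2 of the
-- two runs.  Scaling by a large L and adding d² makes the steps strictly increasing inside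
-- each run as well.  With Qₙ = ⌊6M² / n⌋ and M ≤ n ≤ 2M, each run has at least M steps, whereas d
-- and n + d stay in a window of length O(M) around 6M².
module Submission where

open import Defs
open import Data.Nat using (ℕ; _≤_; _>_)
open import Data.Integer using (ℤ)
open import Data.List using (List; length)
open import Data.Product using (Σ; _×_)

open import Algebra.Bundles using (AbelianGroup)
open import Data.Integer as ℤ using ()
import Data.Integer.Properties as ℤₚ
open import Algebra.Properties.Group (AbelianGroup.group ℤₚ.+-0-abelianGroup) as ℤ+ using ()
import Data.Integer.Tactic.RingSolver as ℤSolver
open import Data.List using ([]; _∷_; map; applyUpTo)
open import Data.List.Membership.Propositional using (_∈_)
open import Data.List.Membership.Propositional.Properties using (∈-applyUpTo⁺)
open import Data.List.Properties using (length-map; length-applyUpTo)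
open import Data.List.Relation.Binary.Sublist.Propositional using (_⊆_; []; _∷_; _∷ʳ_)
open import Data.List.Relation.Binary.Sublist.Propositional.Properties using (All-resp-⊆)
open import Data.List.Relation.Unary.All as All using (All; []; _∷_)
import Data.List.Relation.Unary.All.Properties as Allₚ
open import Data.List.Relation.Unary.AllPairs as AllPairs using (AllPairs; []; _∷_)
open import Data.List.Relation.Unary.Any using (here; there)
open import Data.List.Relation.Unary.Linked as Linked using (Linked; [-]; _∷_)
open import Data.List.Relation.Unary.Linked.Properties using (Linked⇒AllPairs)
open import Data.List.Relation.Unary.Unique.Propositional using (Unique)
open import Data.List.Relation.Unary.Unique.Propositional.Properties using (applyUpTo⁺₁)
open import Data.Nat using (zero; suc; _<_; _+_; _*_; _∸_; _^_; z≤n; s≤s; _/_; _%_)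
open import Data.Nat.DivMod using (m≡m%n+[m/n]*n; m%n<n; m/n*n≤m)
open import Data.Nat.ListAction using (sum)
open import Data.Nat.Properties
open import Data.Nat.Tactic.RingSolver using (solve-∀)
open import Data.Product using (∃; ∃₂; _,_; proj₁)
open import Data.Sum using (inj₁; inj₂)
open import Function using (_∘_)
open import Level using (0ℓ)
open import Relation.Binary using (Rel)
open import Relation.Binary.PropositionalEquality
open import Relation.Nullary using (yes; no; contradiction)

-- Finite sums over lists, up to Cauchy-Schwarz.

private variable
  A B : Set

∑ : List A → (A → ℕ) → ℕ
∑ xs f = sum (map f xs)

∑-mono-≤ : ∀ (xs : List A) {f g : A → ℕ} → (∀ {x} → x ∈ xs → f x ≤ g x) → ∑ xs f ≤ ∑ xs g
∑-mono-≤ []       f≤g = z≤n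
∑-mono-≤ (x ∷ xs) f≤g = +-mono-≤ (f≤g (here refl)) (∑-mono-≤ xs (f≤g ∘ there))

∑-cong : ∀ (xs : List A) {f g : A → ℕ} → (∀ x → f x ≡ g x) → ∑ xs f ≡ ∑ xs g
∑-cong []       f≡g = refl
∑-cong (x ∷ xs) f≡g = cong₂ _+_ (f≡g x) (∑-cong xs f≡g)

∑-const : ∀ (xs : List A) c → ∑ xs (λ _ → c) ≡ length xs * c
∑-const []       c = refl
∑-const (x ∷ xs) c = cong (c +_) (∑-const xs c)

∑-distrib-+ : ∀ (xs : List A) (f g : A → ℕ) → ∑ xs (λ x → f x + g x) ≡ ∑ xs f + ∑ xs g
∑-distrib-+ []       f g = refl
∑-distrib-+ (x ∷ xs) f g = begin
  f x + g x + ∑ xs (λ y → f y + g y)  ≡⟨ cong (f x + g x +_) (∑-distrib-+ xs f g) ⟩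
  f x + g x + (∑ xs f + ∑ xs g)       ≡⟨ interchange (f x) (g x) (∑ xs f) (∑ xs g) ⟩
  f x + ∑ xs f + (g x + ∑ xs g)       ∎
  where
  open ≡-Reasoning
  interchange : ∀ a b c d → a + b + (c + d) ≡ a + c + (b + d)
  interchange = solve-∀

∑-*ˡ : ∀ (xs : List A) c (f : A → ℕ) → ∑ xs (λ x → c * f x) ≡ c * ∑ xs f
∑-*ˡ []       c f = sym (*-zeroʳ c)
∑-*ˡ (x ∷ xs) c f = trans (cong (c * f x +_) (∑-*ˡ xs c f)) (sym (*-distribˡ-+ c (f x) (∑ xs f)))

∑-*ʳ : ∀ (xs : List A) c (f : A → ℕ) → ∑ xs (λ x → f x * c) ≡ ∑ xs f * c
∑-*ʳ xs c f = trans (∑-cong xs λ x → *-comm (f x) c) (trans (∑-*ˡ xs c f) (*-comm c (∑ xs f)))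

∑-swap : ∀ (xs : List A) (ys : List B) (f : A → B → ℕ) →
         ∑ xs (λ x → ∑ ys (f x)) ≡ ∑ ys (λ y → ∑ xs (λ x → f x y))
∑-swap []       ys f = sym (trans (∑-const ys 0) (*-zeroʳ (length ys)))
∑-swap (x ∷ xs) ys f =
  trans (cong (∑ ys (f x) +_) (∑-swap xs ys f)) (sym (∑-distrib-+ ys (f x) _))

∑-square : ∀ (xs : List A) (f : A → ℕ) → ∑ xs f * ∑ xs f ≡ ∑ xs (λ x → ∑ xs (λ y → f x * f y))
∑-square xs f = sym (trans (∑-cong xs λ x → ∑-*ˡ xs (f x) f) (∑-*ʳ xs (∑ xs f) f))

≤-∑ : ∀ {xs : List A} (f : A → ℕ) {x} → x ∈ xs → f x ≤ ∑ xs f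
≤-∑ f (here refl)             = m≤m+n _ _
≤-∑ f (there {x = x} x∈xs)    = m≤n⇒m≤o+n (f x) (≤-∑ f x∈xs)

∑>0⇒∃ : ∀ (xs : List A) (f : A → ℕ) → ∑ xs f > 0 → ∃ λ x → x ∈ xs × f x > 0
∑>0⇒∃ (x ∷ xs) f s>0 with f x in eq
... | suc _ = x , here refl , subst (_> 0) (sym eq) (s≤s z≤n)
... | zero with y , y∈xs , fy>0 ← ∑>0⇒∃ xs f s>0 = y , there y∈xs , fy>0

-- Two positive terms would sit at equal entries, which `Unique` forbids. This bounds both
-- multiplicities and off-diagonal codegrees.
∑-≤1 : ∀ {xs : List A} (f : A → ℕ) → Unique xs → (∀ x → f x ≤ 1) →
       (∀ {x y} → x ∈ xs → y ∈ xs → f x > 0 → f y > 0 → x ≡ y) → ∑ xs f ≤ 1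
∑-≤1 f [] f≤1 inj = z≤n
∑-≤1 {xs = x ∷ xs} f (x∉xs ∷ u) f≤1 inj with f x in eq
... | zero = ∑-≤1 f u f≤1 λ y∈xs z∈xs → inj (there y∈xs) (there z∈xs)
... | suc k with ∑ xs f in eq′
...   | zero  = subst (_≤ 1) (trans eq (sym (+-identityʳ (suc k)))) (f≤1 x)
...   | suc _ with y , y∈xs , fy>0 ← ∑>0⇒∃ xs f (subst (_> 0) (sym eq′) (s≤s z≤n)) =
  contradiction (inj (here refl) (there y∈xs) (subst (_> 0) (sym eq) (s≤s z≤n)) fy>0)
                (All.lookup x∉xs y∈xs)

-- Made for a row of the codegree matrix: `x` is the diagonal entry, the only one where the value
-- may exceed 1.
∑-≤-length+ : ∀ {xs : List A} (f : A → ℕ) {c x} → Unique xs → x ∈ xs → f x ≤ c →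
              (∀ {y} → y ∈ xs → x ≢ y → f y ≤ 1) → ∑ xs f ≤ length xs + c
∑-≤-length+ {xs = x ∷ xs} f {c} (x∉xs ∷ _) (here refl) fx≤c f≤1 = begin
  f x + ∑ xs f              ≤⟨ +-mono-≤ fx≤c (∑-mono-≤ xs λ y∈xs → f≤1 (there y∈xs) (All.lookup x∉xs y∈xs)) ⟩
  c + ∑ xs (λ _ → 1)        ≡⟨ cong (c +_) (trans (∑-const xs 1) (*-identityʳ (length xs))) ⟩
  c + length xs             ≡⟨ +-comm c (length xs) ⟩
  length xs + c             ≤⟨ n≤1+n _ ⟩
  suc (length xs + c)       ∎
  where open ≤-Reasoning
∑-≤-length+ f (x∉xs ∷ u) (there x∈xs) fx≤c f≤1 =
  +-mono-≤ (f≤1 (here refl) (All.lookup x∉xs x∈xs ∘ sym)) (∑-≤-length+ f u x∈xs fx≤c (f≤1 ∘ there))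

2mn≤m²+n² : ∀ m n → 2 * (m * n) ≤ m * m + n * n
2mn≤m²+n² m n with ≤-total m n
... | inj₁ m≤n with k , refl ← m≤n⇒∃[o]m+o≡n m≤n = m+n≤o⇒m≤o _ (≤-reflexive (eq m k))
  where
  eq : ∀ m k → 2 * (m * (m + k)) + k * k ≡ m * m + (m + k) * (m + k)
  eq = solve-∀
... | inj₂ n≤m with k , refl ← m≤n⇒∃[o]m+o≡n n≤m = m+n≤o⇒m≤o _ (≤-reflexive (eq n k))
  where
  eq : ∀ n k → 2 * ((n + k) * n) + k * k ≡ (n + k) * (n + k) + n * n
  eq = solve-∀

cauchy-schwarz : ∀ (xs : List A) (f : A → ℕ) → ∑ xs f * ∑ xs f ≤ length xs * ∑ xs (λ x → f x * f x)
cauchy-schwarz []       f = z≤n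
cauchy-schwarz (x ∷ xs) f = begin
  (a + s) * (a + s)                      ≡⟨ expand a s ⟩
  a * a + 2 * a * s + s * s              ≤⟨ +-mono-≤ (+-monoʳ-≤ (a * a) cross) (cauchy-schwarz xs f) ⟩
  a * a + (n * (a * a) + t) + n * t      ≡⟨ collect a n t ⟩
  suc n * (a * a + t)                    ∎
  where
  open ≤-Reasoning
  a = f x ; s = ∑ xs f ; n = length xs ; t = ∑ xs (λ y → f y * f y)
  expand : ∀ a s → (a + s) * (a + s) ≡ a * a + 2 * a * s + s * s
  expand = solve-∀
  collect : ∀ a n t → a * a + (n * (a * a) + t) + n * t ≡ suc n * (a * a + t)
  collect = solve-∀
  pointwise : ∀ b → 2 * a * b ≤ a * a + b * b
  pointwise b = subst (_≤ a * a + b * b) (sym (*-assoc 2 a b)) (2mn≤m²+n² a b)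
  cross : 2 * a * s ≤ n * (a * a) + t
  cross = begin
    2 * a * s                            ≡⟨ ∑-*ˡ xs (2 * a) f ⟨
    ∑ xs (λ y → 2 * a * f y)             ≤⟨ ∑-mono-≤ xs (λ {y} _ → pointwise (f y)) ⟩
    ∑ xs (λ y → a * a + f y * f y)       ≡⟨ ∑-distrib-+ xs (λ _ → a * a) (λ y → f y * f y) ⟩
    ∑ xs (λ _ → a * a) + t               ≡⟨ cong (_+ t) (∑-const xs (a * a)) ⟩
    n * (a * a) + t                      ∎

-- Representations in a sumset, and Sidon sets.

δ : ℤ → ℤ → ℕ
δ x y with x ℤ.≟ y
... | yes _ = 1
... | no  _ = 0

δ≤1 : ∀ x y → δ x y ≤ 1
δ≤1 x y with x ℤ.≟ y
... | yes _ = ≤-refl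
... | no  _ = z≤n

δ>0⇒≡ : ∀ x y → δ x y > 0 → x ≡ y
δ>0⇒≡ x y δ>0 with x ℤ.≟ y
... | yes x≡y = x≡y
δ>0⇒≡ x y ()  | no _

δ-refl : ∀ x → δ x x ≡ 1
δ-refl x with x ℤ.≟ x
... | yes _  = refl
... | no x≢x = contradiction refl x≢x

multiplicity : List ℤ → ℤ → ℕ
multiplicity B z = ∑ B (δ z)

multiplicity≤1 : ∀ {B} → Unique B → ∀ z → multiplicity B z ≤ 1
multiplicity≤1 u z = ∑-≤1 (δ z) u (δ≤1 z) λ {x} {y} _ _ p q → trans (sym (δ>0⇒≡ z x p)) (δ>0⇒≡ z y q)

multiplicity>0⇒∈ : ∀ B z → multiplicity B z > 0 → z ∈ B
multiplicity>0⇒∈ B z p with b , b∈B , q ← ∑>0⇒∃ B (δ z) p = subst (_∈ B) (sym (δ>0⇒≡ z b q)) b∈B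

-- Double counting: each entry of `B` has at least one representation, and the sum over `B` is then
-- moved innermost.
length≤∑∑ : ∀ B X Y → (∀ {b} → b ∈ B → ∃₂ λ x y → x ∈ X × y ∈ Y × b ≡ x ℤ.+ y) →
            length B ≤ ∑ X (λ x → ∑ Y (λ y → multiplicity B (x ℤ.+ y)))
length≤∑∑ B X Y B⊆X+Y = begin
  length B                                              ≡⟨ *-identityʳ (length B) ⟨
  length B * 1                                          ≡⟨ ∑-const B 1 ⟨
  ∑ B (λ _ → 1)                                         ≤⟨ ∑-mono-≤ B represented ⟩
  ∑ B (λ b → ∑ X (λ x → ∑ Y (λ y → δ (x ℤ.+ y) b)))     ≡⟨ ∑-swap B X _ ⟩
  ∑ X (λ x → ∑ B (λ b → ∑ Y (λ y → δ (x ℤ.+ y) b)))     ≡⟨ ∑-cong X (λ x → ∑-swap B Y _) ⟩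
  ∑ X (λ x → ∑ Y (λ y → multiplicity B (x ℤ.+ y)))      ∎
  where
  open ≤-Reasoning
  represented : ∀ {b} → b ∈ B → 1 ≤ ∑ X (λ x → ∑ Y (λ y → δ (x ℤ.+ y) b))
  represented b∈B with x , y , x∈X , y∈Y , refl ← B⊆X+Y b∈B = begin
    1                                                   ≡⟨ δ-refl (x ℤ.+ y) ⟨
    δ (x ℤ.+ y) (x ℤ.+ y)                               ≤⟨ ≤-∑ (λ v → δ (x ℤ.+ v) (x ℤ.+ y)) y∈Y ⟩
    ∑ Y (λ v → δ (x ℤ.+ v) (x ℤ.+ y))                   ≤⟨ ≤-∑ (λ u → ∑ Y (λ v → δ (u ℤ.+ v) (x ℤ.+ y))) x∈X ⟩
    ∑ X (λ u → ∑ Y (λ v → δ (u ℤ.+ v) (x ℤ.+ y)))       ∎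

-- The two diagonals of a rectangle have the same sum. Of the two matchings that the Sidon property
-- allows, one cancels to `x ≡ x′`, the other to the excluded `y ≡ y′`.
sidon-no-rectangle : ∀ {B x x′ y y′} → Sidon B → y ≢ y′ →
  x ℤ.+ y ∈ B → x ℤ.+ y′ ∈ B → x′ ℤ.+ y ∈ B → x′ ℤ.+ y′ ∈ B → x ≡ x′
sidon-no-rectangle {B} {x} {x′} {y} {y′} sidon y≢y′ xy xy′ x′y x′y′
  with sidon xy x′y′ x′y xy′ (exchange x x′ y y′)
  where
  exchange : ∀ x x′ y y′ → (x ℤ.+ y) ℤ.+ (x′ ℤ.+ y′) ≡ (x′ ℤ.+ y) ℤ.+ (x ℤ.+ y′)
  exchange = ℤSolver.solve-∀
... | inj₁ (eq , _) = ℤ+.∙-cancelʳ y x x′ eq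
... | inj₂ (eq , _) = contradiction (ℤ+.∙-cancelˡ x y y′ eq) y≢y′

-- The Kővári–Sós–Turán count: two distinct columns of the incidence matrix of B share at most one row.
sidon-sumset-bound : ∀ {B X Y} → Unique B → Unique X → Unique Y → Sidon B →
  (∀ {b} → b ∈ B → ∃₂ λ x y → x ∈ X × y ∈ Y × b ≡ x ℤ.+ y) →
  length B * length B ≤ length X * (length Y * (length Y + length X))
sidon-sumset-bound {B} {X} {Y} uB uX uY sidon B⊆X+Y = begin
  length B * length B                                         ≤⟨ *-mono-≤ cover cover ⟩
  ∑ X row * ∑ X row                                           ≤⟨ cauchy-schwarz X row ⟩
  length X * ∑ X (λ x → row x * row x)                        ≡⟨ cong (length X *_) (∑-cong X λ x → ∑-square Y (e x)) ⟩
  length X * ∑ X (λ x → ∑ Y (λ y → ∑ Y (λ y′ → e x y * e x y′)))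
    -- With the sum over `X` innermost, each pair of columns contributes its number of common rows.
    ≡⟨ cong (length X *_) (trans (∑-swap X Y _) (∑-cong Y λ y → ∑-swap X Y _)) ⟩
  length X * ∑ Y (λ y → ∑ Y (codegree y))                     ≤⟨ *-monoʳ-≤ (length X) (∑-mono-≤ Y codegree-sum≤) ⟩
  length X * ∑ Y (λ _ → length Y + length X)                  ≡⟨ cong (length X *_) (∑-const Y _) ⟩
  length X * (length Y * (length Y + length X))               ∎
  where
  open ≤-Reasoning
  e : ℤ → ℤ → ℕ
  e x y = multiplicity B (x ℤ.+ y)
  row : ℤ → ℕ
  row x = ∑ Y (e x)
  codegree : ℤ → ℤ → ℕ
  codegree y y′ = ∑ X (λ x → e x y * e x y′)
  cover : length B ≤ ∑ X row
  cover = length≤∑∑ B X Y B⊆X+Y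
  ee≤1 : ∀ y y′ x → e x y * e x y′ ≤ 1
  ee≤1 y y′ x = *-mono-≤ (multiplicity≤1 uB (x ℤ.+ y)) (multiplicity≤1 uB (x ℤ.+ y′))
  codegree≤ : ∀ y → codegree y y ≤ length X
  codegree≤ y = begin
    codegree y y      ≤⟨ ∑-mono-≤ X (λ {x} _ → ee≤1 y y x) ⟩
    ∑ X (λ _ → 1)     ≡⟨ trans (∑-const X 1) (*-identityʳ (length X)) ⟩
    length X          ∎
  edges : ∀ y y′ x → e x y * e x y′ > 0 → x ℤ.+ y ∈ B × x ℤ.+ y′ ∈ B
  edges y y′ x p = multiplicity>0⇒∈ B _ (left (e x y) p)
                 , multiplicity>0⇒∈ B _ (left (e x y′) (subst (_> 0) (*-comm (e x y) (e x y′)) p))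
    where
    left : ∀ m {n} → m * n > 0 → m > 0
    left (suc m) _ = s≤s z≤n
  codegree≤1 : ∀ y y′ → y ≢ y′ → codegree y y′ ≤ 1
  codegree≤1 y y′ y≢y′ = ∑-≤1 _ uX (ee≤1 y y′) λ {x} {x′} _ _ p p′ →
    let xy  , xy′  = edges y y′ x p
        x′y , x′y′ = edges y y′ x′ p′
    in sidon-no-rectangle sidon y≢y′ xy xy′ x′y x′y′
  codegree-sum≤ : ∀ {y} → y ∈ Y → ∑ Y (codegree y) ≤ length Y + length X
  codegree-sum≤ {y} y∈Y = ∑-≤-length+ (codegree y) uY y∈Y (codegree≤ y) λ _ → codegree≤1 y _

-- Convexity expressed through gaps of natural numbers.

-- The gaps of x ∷ l are increasing and greater than g; being natural numbers they also make x ∷ l itself increase.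
data Chain (g x : ℕ) : List ℕ → Set where
  []   : Chain g x []
  step : ∀ {y l} h → g < h → x + h ≡ y → Chain h y l → Chain g x (y ∷ l)

Chain⇒increasing : ∀ {g x l} → Chain g x l → Linked ℤ._<_ (map ℤ.+_ (x ∷ l))
Chain⇒increasing []                       = [-]
-- The gap exceeds `g`, so it cannot be zero.
Chain⇒increasing {x = x} (step (suc h) _ refl c) =
  ℤ.+<+ (m<m+n x (s≤s z≤n)) ∷ Chain⇒increasing c

-- The bound `g` is kept as an extra head so that the induction can compare the first gap with it;
-- `Chain⇒Convex` drops it again.
Chain⇒increasing-diffs : ∀ {g x l} → Chain g x l → Linked ℤ._<_ (ℤ.+ g ∷ diffs (map ℤ.+_ (x ∷ l)))
Chain⇒increasing-diffs [] = [-]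
Chain⇒increasing-diffs {g} {x} (step {l = l} h g<h refl c) =
  subst (λ z → Linked ℤ._<_ (ℤ.+ g ∷ z ∷ diffs (map ℤ.+_ (x + h ∷ l)))) (sym gap)
    (ℤ.+<+ g<h ∷ Chain⇒increasing-diffs c)
  where
  cancel : ∀ i j → (i ℤ.+ j) ℤ.- i ≡ j
  cancel = ℤSolver.solve-∀
  gap : ℤ.+ (x + h) ℤ.- ℤ.+ x ≡ ℤ.+ h
  gap = trans (cong (ℤ._- ℤ.+ x) (ℤₚ.pos-+ x h)) (cancel (ℤ.+ x) (ℤ.+ h))

Chain⇒Convex : ∀ {g x l} → Chain g x l → Convex (map ℤ.+_ (x ∷ l))
Chain⇒Convex c = Chain⇒increasing c , Linked.tail (Chain⇒increasing-diffs c)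

AllPairs-resp-⊆ : ∀ {A : Set} {R : Rel A 0ℓ} {xs ys : List A} → xs ⊆ ys → AllPairs R ys → AllPairs R xs
AllPairs-resp-⊆ []          []         = []
AllPairs-resp-⊆ (y ∷ʳ τ)    (_ ∷ rs)   = AllPairs-resp-⊆ τ rs
AllPairs-resp-⊆ (refl ∷ τ)  (r ∷ rs)   = All-resp-⊆ τ r ∷ AllPairs-resp-⊆ τ rs

-- Adjacency is lost when entries are deleted, so the order is first extended to all pairs by
-- transitivity.
increasing⇒unique-sublists : ∀ {xs ys} → Linked ℤ._<_ ys → xs ⊆ ys → Unique xs
increasing⇒unique-sublists inc τ =
  AllPairs.map ℤₚ.<⇒≢ (AllPairs-resp-⊆ τ (Linked⇒AllPairs ℤₚ.<-trans inc))

-- The walk through the runs.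

value : ℕ → ℕ → ℕ → ℕ
value L n d = L * (n * n + 2 * (n * d)) + d * d

module _ (L : ℕ) (Q : ℕ → ℕ) where

  -- The argument names the run being left: this counts the steps of run `n + 1`. The truncated
  -- subtraction is exact where `long-runs` applies.
  runLength : ℕ → ℕ
  runLength n = suc (suc n) * Q (suc n) ∸ n * Q n

  -- The points that follow (n , d), which lies `steps` steps before the end of its run, in this
  -- run and in `runs` further ones.
  walk : (runs steps n d : ℕ) → List ℕ
  walk r       (suc k) n d = value L n (suc d) ∷ walk r k n (suc d)
  walk zero    zero    n d = []
  walk (suc r) zero    n d =
    value L (suc n) (n * Q n) ∷ walk r (runLength n) (suc n) (n * Q n)

  module _ {M T : ℕ}
    (long-runs : ∀ {n} → M ≤ n → n < T → n * Q n + M ≤ suc (suc n) * Q (suc n))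
    where

    runLength-spec : ∀ {n} → M ≤ n → n < T → n * Q n + runLength n ≡ suc (suc n) * Q (suc n)
    runLength-spec {n} M≤n n<T = m+[n∸m]≡n (m+n≤o⇒m≤o (n * Q n) (long-runs M≤n n<T))

    M≤runLength : ∀ {n} → M ≤ n → n < T → M ≤ runLength n
    M≤runLength {n} M≤n n<T = +-cancelˡ-≤ (n * Q n) _ _
      (≤-trans (long-runs M≤n n<T) (≤-reflexive (sym (runLength-spec M≤n n<T))))

    -- Each of the `r` runs still to come has at least `M` steps; the landing points of the jumps
    -- are a surplus that is dropped.
    walk-length : ∀ r k n d → M ≤ n → n + r ≤ T → r * M + k ≤ length (walk r k n d)
    walk-length zero    zero    n d M≤n n+r≤T = z≤n
    walk-length r       (suc k) n d M≤n n+r≤T =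
      ≤-trans (≤-reflexive (+-suc (r * M) k)) (s≤s (walk-length r k n (suc d) M≤n n+r≤T))
    walk-length (suc r) zero    n d M≤n n+r≤T = begin
      M + r * M + 0                                        ≡⟨ trans (+-identityʳ (M + r * M)) (+-comm M (r * M)) ⟩
      r * M + M                                            ≤⟨ +-monoʳ-≤ (r * M) (M≤runLength M≤n n<T) ⟩
      r * M + runLength n                                  ≤⟨ walk-length r (runLength n) (suc n) (n * Q n) (m≤n⇒m≤1+n M≤n) n+r≤T′ ⟩
      length (walk r (runLength n) (suc n) (n * Q n))      ≤⟨ n≤1+n _ ⟩
      suc (length (walk r (runLength n) (suc n) (n * Q n))) ∎
      where
      open ≤-Reasoning
      n+r≤T′ : suc n + r ≤ T
      n+r≤T′ = ≤-trans (≤-reflexive (sym (+-suc n r))) n+r≤T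
      n<T = m+n≤o⇒m≤o (suc n) n+r≤T′

    -- By the invariant `d + k ≡ suc n * Q n`, the run ends after `k` more steps, so `d` stays below
    -- `hi`. Steps only raise `d`, and a jump lands at some `n * Q n`, so `d` stays above `lo`.
    walk-all : ∀ {lo hi} →
      (∀ {n} → M ≤ n → n ≤ T → lo ≤ n * Q n) →
      (∀ {n} → M ≤ n → n ≤ T → suc n * Q n ≤ hi) →
      ∀ {P : ℕ → Set} → (∀ {n d} → M ≤ n → n ≤ T → lo ≤ d → d ≤ hi → P (value L n d)) →
      ∀ r k n d → M ≤ n → n + r ≤ T → d + k ≡ suc n * Q n → lo ≤ d → All P (walk r k n d)
    walk-all lo≤ ≤hi p zero    zero    n d M≤n n+r≤T d+k≡ lo≤d = []
    walk-all lo≤ ≤hi p r       (suc k) n d M≤n n+r≤T d+k≡ lo≤d =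
      p M≤n n≤T lo≤1+d (≤-trans (m+n≤o⇒m≤o (suc d) (≤-reflexive d+k≡′)) (≤hi M≤n n≤T))
      ∷ walk-all lo≤ ≤hi p r k n (suc d) M≤n n+r≤T d+k≡′ lo≤1+d
      where
      n≤T = m+n≤o⇒m≤o n n+r≤T
      lo≤1+d = m≤n⇒m≤1+n lo≤d
      d+k≡′ = trans (sym (+-suc d k)) d+k≡
    walk-all {lo} {hi} lo≤ ≤hi p (suc r) zero n d M≤n n+r≤T d+k≡ lo≤d =
      p M≤1+n n<T lo≤nQ (≤-trans (m+n≤o⇒m≤o (n * Q n) (≤-reflexive spec)) (≤hi M≤1+n n<T))
      ∷ walk-all lo≤ ≤hi p r (runLength n) (suc n) (n * Q n) M≤1+n n+r≤T′ spec lo≤nQ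
      where
      n+r≤T′ : suc n + r ≤ T
      n+r≤T′ = ≤-trans (≤-reflexive (sym (+-suc n r))) n+r≤T
      n<T = m+n≤o⇒m≤o (suc n) n+r≤T′
      M≤1+n = m≤n⇒m≤1+n M≤n
      lo≤nQ = lo≤ M≤n (<⇒≤ n<T)
      spec = runLength-spec M≤n n<T

    -- The next step inside run `n` has gap `L * (2 * n) + 2 * d + 1`; the invariant on `g` says
    -- that this would exceed the previous gap. The hypothesis on `L` makes a jump exceed it too.
    walk-chain :
      (∀ {n} → M ≤ n → n ≤ T → 2 * (suc n * Q n) + (2 * n + 1) * (Q n * Q n) < L) →
      ∀ r k n d g → M ≤ n → n + r ≤ T → d + k ≡ suc n * Q n → g ≤ L * (2 * n) + 2 * d →
      Chain g (value L n d) (walk r k n d)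
    walk-chain large zero    zero    n d g M≤n n+r≤T d+k≡ g≤ = []
    walk-chain large r       (suc k) n d g M≤n n+r≤T d+k≡ g≤ =
      step (suc (L * (2 * n) + 2 * d)) (s≤s g≤) (next L n d)
        (walk-chain large r k n (suc d) _ M≤n n+r≤T (trans (sym (+-suc d k)) d+k≡) bound)
      where
      next : ∀ L n d → L * (n * n + 2 * (n * d)) + d * d + suc (L * (2 * n) + 2 * d)
                     ≡ L * (n * n + 2 * (n * suc d)) + suc d * suc d
      next = solve-∀
      bound : suc (L * (2 * n) + 2 * d) ≤ L * (2 * n) + 2 * suc d
      bound = m+n≤o⇒m≤o _ (≤-reflexive (eq (L * (2 * n)) d))
        where
        eq : ∀ a d → suc (a + 2 * d) + 1 ≡ a + 2 * suc d
        eq = solve-∀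
    walk-chain large (suc r) zero    n d g M≤n n+r≤T d+k≡ g≤
      with j , L≡ ← m≤n⇒∃[o]m+o≡n (large M≤n (m+n≤o⇒m≤o n n+r≤T)) =
      step gap g<gap jump
        (walk-chain large r (runLength n) (suc n) (n * Q n) gap (m≤n⇒m≤1+n M≤n) n+r≤T′
          (runLength-spec M≤n (m+n≤o⇒m≤o (suc n) n+r≤T′)) gap≤)
      where
      q = Q n
      -- The unperturbed jump is `L * (2 * n + 1)`, and d² drops by `(2 * n + 1) * (q * q)`. So `c`
      -- is `L` minus this drop, written with the slack `j` to avoid subtraction; its first summand
      -- beats `2 * d`.
      c = suc (2 * (suc n * q)) + j
      gap = L * (2 * n) + c
      n+r≤T′ : suc n + r ≤ T
      n+r≤T′ = ≤-trans (≤-reflexive (sym (+-suc n r))) n+r≤T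
      d≡ : d ≡ suc n * q
      d≡ = trans (sym (+-identityʳ d)) d+k≡
      c+≡L : c + (2 * n + 1) * (q * q) ≡ L
      c+≡L = trans (eq (2 * (suc n * q)) ((2 * n + 1) * (q * q)) j) L≡
        where
        eq : ∀ a b j → suc a + j + b ≡ suc (a + b) + j
        eq = solve-∀
      g<gap : g < gap
      g<gap = ≤-trans (s≤s g≤) (≤-trans (≤-reflexive (sym (+-suc (L * (2 * n)) (2 * d))))
        (+-monoʳ-≤ (L * (2 * n)) (subst (λ d → suc (2 * d) ≤ c) (sym d≡)
          (m≤m+n _ j))))
      gap≤ : gap ≤ L * (2 * suc n) + 2 * (n * q)
      gap≤ = begin
        L * (2 * n) + c                          ≤⟨ +-monoʳ-≤ (L * (2 * n)) (m+n≤o⇒m≤o c (≤-reflexive c+≡L)) ⟩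
        L * (2 * n) + L                          ≤⟨ m≤m+n _ (L + 2 * (n * q)) ⟩
        L * (2 * n) + L + (L + 2 * (n * q))      ≡⟨ eq L n (2 * (n * q)) ⟩
        L * (2 * suc n) + 2 * (n * q)            ∎
        where
        open ≤-Reasoning
        eq : ∀ L n a → L * (2 * n) + L + (L + a) ≡ L * (2 * suc n) + a
        eq = solve-∀
      jump : value L n d + gap ≡ value L (suc n) (n * q)
      jump = subst₂ (λ d L → value L n d + (L * (2 * n) + c) ≡ value L (suc n) (n * q)) (sym d≡) c+≡L (eq c n q)
        where
        eq : ∀ c n q →
          (c + (2 * n + 1) * (q * q)) * (n * n + 2 * (n * (suc n * q))) + suc n * q * (suc n * q)
            + ((c + (2 * n + 1) * (q * q)) * (2 * n) + c)
          ≡ (c + (2 * n + 1) * (q * q)) * (suc n * suc n + 2 * (suc n * (n * q))) + n * q * (n * q)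
        eq = solve-∀

-- Choice of parameters, and the sumset containing the walk.

fourth-power-bound : ∀ {a c M l} → a * a ≤ c * (M * (M * M)) → M * M ≤ l → a ^ 4 ≤ c * c * l ^ 3
fourth-power-bound {a} {c} {M} {l} a²≤ M²≤l = begin
  a ^ 4                                          ≡⟨ fourth a ⟩
  a * a * (a * a)                                ≤⟨ *-mono-≤ a²≤ a²≤ ⟩
  -- The exponent 3/4 arises here: the square of M³ is the cube of M².
  c * (M * (M * M)) * (c * (M * (M * M)))        ≡⟨ sixth c M ⟩
  c * c * (M * M) ^ 3                            ≤⟨ *-monoʳ-≤ (c * c) (^-monoˡ-≤ 3 M²≤l) ⟩
  c * c * l ^ 3                                  ∎
  where
  open ≤-Reasoning
  fourth : ∀ a → a * (a * (a * (a * 1))) ≡ a * a * (a * a)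
  fourth = solve-∀
  sixth : ∀ c M → c * (M * (M * M)) * (c * (M * (M * M))) ≡ c * c * (M * M * (M * M * (M * M * 1)))
  sixth = solve-∀

-- Both lists get a positive factor: for `X` it is `L`, that is `suc k`, and for `Y` it is `k`, that
-- is `suc k₀`.
scaled-squares-increasing : ∀ k lo {i j} → i < j →
  suc k * ((lo + i) * (lo + i)) < suc k * ((lo + j) * (lo + j))
scaled-squares-increasing k lo i<j = *-monoʳ-< (suc k) (*-mono-< lo+i<lo+j lo+i<lo+j)
  where lo+i<lo+j = +-monoʳ-< lo i<j

-- With L = k + 1 the value is L(n + d)² - (L - 1)d². One term depends on `n + d` alone, the other
-- on `d` alone, which puts the walk into a sumset.
value-split : ∀ k n d →
  ℤ.+ value (suc k) n d ≡ ℤ.+ (suc k * ((n + d) * (n + d))) ℤ.+ ℤ.- (ℤ.+ (k * (d * d)))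
value-split k n d = trans (cancel (ℤ.+ value (suc k) n d) (ℤ.+ (k * (d * d))))
  (cong (ℤ._- ℤ.+ (k * (d * d)))
    (trans (sym (ℤₚ.pos-+ (value (suc k) n d) (k * (d * d)))) (cong ℤ.+_ (eq k n d))))
  where
  cancel : ∀ i j → i ≡ (i ℤ.+ j) ℤ.- j
  cancel = ℤSolver.solve-∀
  eq : ∀ k n d → suc k * (n * n + 2 * (n * d)) + d * d + k * (d * d) ≡ suc k * ((n + d) * (n + d))
  eq = solve-∀

module Construction (m : ℕ) where

  -- lo ≤ d ≤ hi on the walk, and hi ≤ lo + 8M; hence n + d ≤ lo + 10M.  L is chosen so that the
  -- perturbation d² does not spoil the comparison of the jumps with the steps.
  M E T lo hi k₀ k L p : ℕ
  M  = suc m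
  T  = 2 * M
  E  = 6 * M * M
  lo = E ∸ T
  hi = 6 * M + E
  k₀ = 2 * (suc T * (6 * M)) + (2 * T + 1) * (6 * M * (6 * M))
  k  = suc k₀
  L  = suc k
  p  = 11 * M

  Q : ℕ → ℕ
  -- A default that avoids division by zero; the walk only visits n ≥ M ≥ 1.
  Q zero    = 0
  Q (suc n) = E / suc n

  nQ≤E : ∀ n → n * Q n ≤ E
  nQ≤E zero    = z≤n
  nQ≤E (suc n) = ≤-trans (≤-reflexive (*-comm (suc n) (Q (suc n)))) (m/n*n≤m E (suc n))

  -- The remainder of `E` modulo `n` is below `n`; with `nQ≤E` this pins `n * Q n` to within `n` of
  -- `E`.
  E<nQ+n : ∀ {n} → M ≤ n → E < n * Q n + n
  E<nQ+n {suc n} _ = begin-strict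
    E                                      ≡⟨ m≡m%n+[m/n]*n E (suc n) ⟩
    E % suc n + Q (suc n) * suc n          <⟨ +-monoˡ-< (Q (suc n) * suc n) (m%n<n E (suc n)) ⟩
    suc n + Q (suc n) * suc n              ≡⟨ +-comm (suc n) _ ⟩
    Q (suc n) * suc n + suc n              ≡⟨ cong (_+ suc n) (*-comm (Q (suc n)) (suc n)) ⟩
    suc n * Q (suc n) + suc n              ∎
    where open ≤-Reasoning

  Q≤6M : ∀ {n} → M ≤ n → Q n ≤ 6 * M
  Q≤6M {n} M≤n = *-cancelʳ-≤ (Q n) (6 * M) M (begin
    Q n * M      ≤⟨ *-monoʳ-≤ (Q n) M≤n ⟩
    Q n * n      ≡⟨ *-comm (Q n) n ⟩
    n * Q n      ≤⟨ nQ≤E n ⟩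
    E            ∎)
    where open ≤-Reasoning

  3M≤Q : ∀ {n} → M ≤ n → n ≤ T → 3 * M ≤ Q n
  3M≤Q {n} M≤n n≤T = ≤-pred (*-cancelˡ-< n (3 * M) (suc (Q n)) (begin-strict
    n * (3 * M)            ≤⟨ *-monoˡ-≤ (3 * M) n≤T ⟩
    2 * M * (3 * M)        ≡⟨ eq M ⟩
    E                      <⟨ E<nQ+n M≤n ⟩
    n * Q n + n            ≡⟨ trans (+-comm (n * Q n) n) (sym (*-suc n (Q n))) ⟩
    n * suc (Q n)          ∎))
    where
    open ≤-Reasoning
    eq : ∀ M → 2 * M * (3 * M) ≡ 6 * M * M
    eq = solve-∀

  -- `n * Q n` exceeds `suc n * Q (suc n)` by less than `suc n`, which is at most 2M. Adding `M`
  -- costs 3M in total, paid by the extra copy of `Q (suc n)`; the factor 6 in `E` makes that copy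
  -- large enough.
  long-runs : ∀ {n} → M ≤ n → n < T → n * Q n + M ≤ suc (suc n) * Q (suc n)
  long-runs {n} M≤n n<T = begin
    n * Q n + M                              ≤⟨ +-monoˡ-≤ M (≤-trans (nQ≤E n) (<⇒≤ (E<nQ+n M≤1+n))) ⟩
    suc n * Q (suc n) + suc n + M            ≤⟨ +-monoˡ-≤ M (+-monoʳ-≤ (suc n * Q (suc n)) n<T) ⟩
    suc n * Q (suc n) + 2 * M + M            ≡⟨ eq (suc n * Q (suc n)) M ⟩
    3 * M + suc n * Q (suc n)                ≤⟨ +-monoˡ-≤ (suc n * Q (suc n)) (3M≤Q M≤1+n n<T) ⟩
    Q (suc n) + suc n * Q (suc n)            ∎
    where
    open ≤-Reasoning
    M≤1+n = m≤n⇒m≤1+n M≤n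
    eq : ∀ a M → a + 2 * M + M ≡ 3 * M + a
    eq = solve-∀

  -- `k₀` is the left side with `n` and `Q n` replaced by their upper bounds `T` and `6 * M`.
  L-large : ∀ {n} → M ≤ n → n ≤ T → 2 * (suc n * Q n) + (2 * n + 1) * (Q n * Q n) < L
  L-large M≤n n≤T = s≤s (m≤n⇒m≤1+n (+-mono-≤
    (*-monoʳ-≤ 2 (*-mono-≤ (s≤s n≤T) Q≤))
    (*-mono-≤ (+-monoˡ-≤ 1 (*-monoʳ-≤ 2 n≤T)) (*-mono-≤ Q≤ Q≤))))
    where Q≤ = Q≤6M M≤n

  lo≤nQ : ∀ {n} → M ≤ n → n ≤ T → lo ≤ n * Q n
  lo≤nQ {n} M≤n n≤T = m≤n+o⇒m∸n≤o E T (begin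
    E              ≤⟨ <⇒≤ (E<nQ+n M≤n) ⟩
    n * Q n + n    ≤⟨ +-monoʳ-≤ (n * Q n) n≤T ⟩
    n * Q n + T    ≡⟨ +-comm (n * Q n) T ⟩
    T + n * Q n    ∎)
    where open ≤-Reasoning

  [1+n]Q≤hi : ∀ {n} → M ≤ n → n ≤ T → suc n * Q n ≤ hi
  [1+n]Q≤hi {n} M≤n _ = +-mono-≤ (Q≤6M M≤n) (nQ≤E n)

  ξ η : ℕ → ℤ
  ξ i = ℤ.+ (L * ((lo + i) * (lo + i)))
  η j = ℤ.- (ℤ.+ (k * ((lo + j) * (lo + j))))

  X Y : List ℤ
  X = applyUpTo ξ p
  Y = applyUpTo η p

  X-unique : Unique X
  X-unique = applyUpTo⁺₁ ξ p λ i<j _ eq →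
    <⇒≢ (scaled-squares-increasing k lo i<j) (ℤₚ.+-injective eq)

  Y-unique : Unique Y
  Y-unique = applyUpTo⁺₁ η p λ i<j _ eq →
    <⇒≢ (scaled-squares-increasing k₀ lo i<j) (ℤₚ.+-injective (ℤₚ.neg-injective eq))

  InSumset : ℤ → Set
  InSumset z = ∃₂ λ x y → x ∈ X × y ∈ Y × z ≡ x ℤ.+ y

  value-inSumset : ∀ {n d} → M ≤ n → n ≤ T → lo ≤ d → d ≤ hi → InSumset (ℤ.+ value L n d)
  value-inSumset {n} M≤n n≤T lo≤d d≤hi with j , refl ← m≤n⇒∃[o]m+o≡n lo≤d =
    -- Offsets are counted from `lo`: d = lo + j and n + d = lo + (n + j), where j ≤ 8M and n ≤ 2M.
    ξ (n + j) , η j , ∈-applyUpTo⁺ ξ n+j<p , ∈-applyUpTo⁺ η (≤-<-trans (m≤n+m j n) n+j<p) ,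
    trans (value-split k n (lo + j))
      (cong (λ e → ℤ.+ (L * (e * e)) ℤ.+ η j) (shift n lo j))
    where
    open ≤-Reasoning
    shift : ∀ n a j → n + (a + j) ≡ a + (n + j)
    shift = solve-∀
    j≤8M : j ≤ 8 * M
    j≤8M = +-cancelˡ-≤ lo j (8 * M) (begin
      lo + j                       ≤⟨ d≤hi ⟩
      6 * M + E                    ≤⟨ +-monoʳ-≤ (6 * M) (m≤n+m∸n E T) ⟩
      6 * M + (2 * M + lo)         ≡⟨ eq M lo ⟩
      lo + 8 * M                   ∎)
      where
      eq : ∀ M a → 6 * M + (2 * M + a) ≡ a + 8 * M
      eq = solve-∀
    n+j<p : n + j < p
    n+j<p = begin-strict
      n + j                        ≤⟨ +-mono-≤ n≤T j≤8M ⟩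
      2 * M + 8 * M                ≡⟨ *-distribʳ-+ M 2 8 ⟨
      10 * M                       <⟨ m<n+m (10 * M) (s≤s z≤n) ⟩
      11 * M                       ∎

  -- The walk starts at the end of run `M`, so its first move is a jump and the complete runs M + 1,
  -- ..., 2M follow.
  d₀ : ℕ
  d₀ = suc M * Q M

  values : List ℕ
  values = value L M d₀ ∷ walk L Q M 0 M d₀

  convexSet : List ℤ
  convexSet = map ℤ.+_ values

  M+M≤T : M + M ≤ T
  M+M≤T = +-monoʳ-≤ M (≤-reflexive (sym (+-identityʳ M)))

  M≤T : M ≤ T
  M≤T = m+n≤o⇒m≤o M M+M≤T

  lo≤d₀ : lo ≤ d₀
  lo≤d₀ = ≤-trans (lo≤nQ ≤-refl M≤T) (m≤n+m (M * Q M) (Q M))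

  convexSet-convex : Convex convexSet
  convexSet-convex = Chain⇒Convex (walk-chain L Q long-runs L-large M 0 M d₀ 0
    ≤-refl M+M≤T (+-identityʳ d₀) z≤n)

  convexSet-inSumset : All InSumset convexSet
  convexSet-inSumset = Allₚ.map⁺ (value-inSumset ≤-refl M≤T lo≤d₀ ([1+n]Q≤hi ≤-refl M≤T)
    ∷ walk-all L Q long-runs lo≤nQ [1+n]Q≤hi value-inSumset M 0 M d₀
        ≤-refl M+M≤T (+-identityʳ d₀) lo≤d₀)

  M²≤length : M * M ≤ length convexSet
  M²≤length = begin
    M * M                                                      ≤⟨ m≤m+n (M * M) 0 ⟩
    M * M + 0                                                  ≤⟨ walk-length L Q long-runs M 0 M d₀ ≤-refl M+M≤T ⟩
    length (walk L Q M 0 M d₀)                                 ≤⟨ n≤1+n _ ⟩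
    length values                                              ≡⟨ length-map ℤ.+_ values ⟨
    length convexSet                                           ∎
    where open ≤-Reasoning

  sidon-square : ∀ {B} → B ⊆ convexSet → Sidon B → length B * length B ≤ 2 * (11 * (11 * 11)) * (M * (M * M))
  sidon-square {B} B⊆convexSet sidon = begin
    length B * length B
      ≤⟨ sidon-sumset-bound (increasing⇒unique-sublists (proj₁ convexSet-convex) B⊆convexSet)
           X-unique Y-unique sidon (All.lookup (All-resp-⊆ B⊆convexSet convexSet-inSumset)) ⟩
    length X * (length Y * (length Y + length X))
      ≡⟨ cong₂ (λ x y → x * (y * (y + x))) (length-applyUpTo ξ p) (length-applyUpTo η p) ⟩
    p * (p * (p + p))                       ≡⟨ eq 11 M ⟩
    2 * (11 * (11 * 11)) * (M * (M * M))    ∎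
    where
    open ≤-Reasoning
    eq : ∀ a M → a * M * (a * M * (a * M + a * M)) ≡ 2 * (a * (a * a)) * (M * (M * M))
    eq = solve-∀

theorem1p5 : Σ ℕ λ K → K > 0 × ((N : ℕ) → Σ (List ℤ) λ A → Convex A × N ≤ length A × SidonBound K A)
theorem1p5 = c * c , s≤s z≤n , λ N →
  let open Construction N in
  -- Here `M` is `suc N`, so N ≤ M ≤ M².
  convexSet , convexSet-convex , ≤-trans (n≤1+n N) (≤-trans (m≤m*n M M) M²≤length) ,
  λ B B⊆A sidon → fourth-power-bound {length B} {c} {M} (sidon-square B⊆A sidon) M²≤length
  where
  c : ℕ
  c = 2 * (11 * (11 * 11))
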